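{- Let $p$ be an integer greater than $1$ and let $G$ be a connected $\{\text{butterfly},\text{hammer},(K_1\cup K_2)+K_p\}$-free graph. If $\omega(G)\geq 2p$, then $G$ is a multisplit graph.
   Context: All graphs are simple, finite and undirected. $\omega(G)$ is the clique number of $G$. For a family $\mathcal{F}$ of graphs, $G$ is $\mathcal{F}$-free if it has no induced subgraph isomorphic to a member of $\mathcal{F}$. The butterfly is the graph on five vertices consisting of two triangles sharing exactly one vertex (with no other edges). The hammer is the graph on five vertices $a,b,c,d,e$ with edges $ab,bc,ac,cd,de$. $K_n$ is the complete graph on $n$ vertices, $K_1\cup K_2$ is the disjoint union of $K_1$ and $K_2$, and for vertex-disjoint graphs $G_1,G_2$ the join $G_1+G_2$ is obtained from their disjoint union by adding all edges between $V(G_1)$ and $V(G_2)$. A graph $G$ is a multisplit graph if $V(G)$ can be partitioned into two subsets $V_1$ and $V_2$ such that $V_1$ induces a complete multipartite graph and $V_2$ is an independent set in $G$. -}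

module Defs where

open import Data.Fin using (Fin; zero; suc; #_)
open import Data.Fin.Properties using (_≟_; all?)
open import Data.Fin.Subset using (Subset; inside; outside; _∈_; ∁; ∣_∣)
open import Data.Fin.Subset.Properties using (_∈?_)
open import Data.List using (List; []; _∷_; _++_; map; filter)
open import Data.List.Extrema.Nat using (max)
open import Data.List.Relation.Unary.All as All using (All; []; _∷_)
open import Data.Nat using (ℕ; zero; suc)
open import Data.Product using (_×_; _,_; ∃; Σ-syntax; ∃-syntax; proj₁)
open import Data.Product.Properties using (≡-dec)
open import Data.Sum using (_⊎_; inj₁; inj₂; swap; [_,_]′)
open import Data.Unit using (⊤; tt)
open import Data.Empty using (⊥)
open import Data.Vec using ([]; _∷_)
open import Function using (_⇔_; _↔_; Inverse; _on_)
open import Level using (0ℓ)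
open import Relation.Binary using (Rel; Symmetric; Irreflexive; Decidable)
open import Relation.Binary.Construct.Closure.ReflexiveTransitive using (Star)
open import Relation.Binary.PropositionalEquality using (_≡_; _≢_; refl; ≢-sym)
open import Relation.Nullary using (Dec; yes; no; ¬_; ¬?; _⊎-dec_; _→-dec_)

-- Finiteness is not a field: it comes from the vertex types, which are Fin n,
-- sums of these, or the elements of a Subset n.
record Graph (V : Set) : Set₁ where
  field
    Adj    : Rel V 0ℓ
    symm   : Symmetric Adj
    irrefl : Irreflexive _≡_ Adj
    adj?   : Decidable Adj

open Graph public

infix 4 _≅_
_≅_ : ∀ {V W} → Graph V → Graph W → Set
_≅_ {V} {W} G H =
  Σ[ f ∈ V ↔ W ] (∀ u v → Adj G u v ⇔ Adj H (Inverse.to f u) (Inverse.to f v))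

infix 8 _[_]
_[_] : ∀ {n} → Graph (Fin n) → (S : Subset n) → Graph (∃ (_∈ S))
G [ S ] = record
  { Adj    = Adj G on proj₁
  ; symm   = symm G
  ; irrefl = λ { refl → irrefl G refl }
  ; adj?   = λ u v → adj? G (proj₁ u) (proj₁ v)
  }

infix 4 _-free_
_-free_ : ∀ {n} → List (∃ Graph) → Graph (Fin n) → Set₁
𝓕 -free G = All (λ (_ , H) → ¬ (∃[ S ] H ≅ G [ S ])) 𝓕

K : ∀ n → Graph (Fin n)
K n = record
  { Adj    = _≢_
  ; symm   = ≢-sym
  ; irrefl = λ u≡v u≢v → u≢v u≡v
  ; adj?   = λ u v → ¬? (u ≟ v)
  }

-- The two operations differ only in whether vertices from different summands
-- are adjacent, as prescribed by C.
module Sum {V W} (G : Graph V) (H : Graph W) (C : Set) (C? : Dec C) where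

  SumAdj : Rel (V ⊎ W) 0ℓ
  SumAdj (inj₁ u) (inj₁ v) = Adj G u v
  SumAdj (inj₂ u) (inj₂ v) = Adj H u v
  SumAdj (inj₁ _) (inj₂ _) = C
  SumAdj (inj₂ _) (inj₁ _) = C

  sum-symm : Symmetric SumAdj
  sum-symm {inj₁ _} {inj₁ _} = symm G
  sum-symm {inj₂ _} {inj₂ _} = symm H
  sum-symm {inj₁ _} {inj₂ _} c = c
  sum-symm {inj₂ _} {inj₁ _} c = c

  sum-irrefl : Irreflexive _≡_ SumAdj
  sum-irrefl {inj₁ _} refl = irrefl G refl
  sum-irrefl {inj₂ _} refl = irrefl H refl

  sum-adj? : Decidable SumAdj
  sum-adj? (inj₁ u) (inj₁ v) = adj? G u v
  sum-adj? (inj₂ u) (inj₂ v) = adj? H u v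
  sum-adj? (inj₁ _) (inj₂ _) = C?
  sum-adj? (inj₂ _) (inj₁ _) = C?

  graph : Graph (V ⊎ W)
  graph = record
    { Adj    = SumAdj
    ; symm   = λ {u} {v} → sum-symm {u} {v}
    ; irrefl = sum-irrefl
    ; adj?   = sum-adj?
    }

infixl 6 _⊍_ _⋈_

-- Disjoint union.
_⊍_ : ∀ {V W} → Graph V → Graph W → Graph (V ⊎ W)
G ⊍ H = Sum.graph G H ⊥ (no λ ())

-- Join, written + in the literature.
_⋈_ : ∀ {V W} → Graph V → Graph W → Graph (V ⊎ W)
G ⋈ H = Sum.graph G H ⊤ (yes tt)

-- The listed edges are unordered; their endpoints must differ.
fromEdges : ∀ {n} (es : List (Fin n × Fin n)) →
            All (λ (a , b) → a ≢ b) es → Graph (Fin n)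
fromEdges es loopless = record
  { Adj    = λ u v → (u , v) ∈ₗ es ⊎ (v , u) ∈ₗ es
  ; symm   = swap
  ; irrefl = λ { refl → [ noLoop , noLoop ]′ }
  ; adj?   = λ u v → ((u , v) ∈ₗ? es) ⊎-dec ((v , u) ∈ₗ? es)
  }
  where
  open import Data.List.Membership.DecPropositional (≡-dec _≟_ _≟_)
    using () renaming (_∈_ to _∈ₗ_; _∈?_ to _∈ₗ?_)

  noLoop : ∀ {u} → ¬ (u , u) ∈ₗ es
  noLoop uu = All.lookup loopless uu refl

butterfly : Graph (Fin 5)
butterfly = fromEdges
  ( (# 0 , # 1) ∷ (# 0 , # 2) ∷ (# 1 , # 2)
  ∷ (# 0 , # 3) ∷ (# 0 , # 4) ∷ (# 3 , # 4) ∷ [])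
  ((λ ()) ∷ (λ ()) ∷ (λ ()) ∷ (λ ()) ∷ (λ ()) ∷ (λ ()) ∷ [])

hammer : Graph (Fin 5)
hammer = fromEdges
  ( (# 0 , # 1) ∷ (# 1 , # 2) ∷ (# 0 , # 2)
  ∷ (# 2 , # 3) ∷ (# 3 , # 4) ∷ [])
  ((λ ()) ∷ (λ ()) ∷ (λ ()) ∷ (λ ()) ∷ (λ ()) ∷ [])

Connected : ∀ {V} → Graph V → Set
Connected G = ∀ u v → Star (Adj G) u v

IsClique : ∀ {n} → Graph (Fin n) → Subset n → Set
IsClique G S = ∀ u v → u ∈ S → v ∈ S → u ≢ v → Adj G u v

isClique? : ∀ {n} (G : Graph (Fin n)) (S : Subset n) → Dec (IsClique G S)
isClique? G S = all? λ u → all? λ v →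
  (u ∈? S) →-dec (v ∈? S) →-dec ¬? (u ≟ v) →-dec adj? G u v

subsets : ∀ n → List (Subset n)
subsets zero    = [] ∷ []
subsets (suc n) = map (outside ∷_) (subsets n) ++ map (inside ∷_) (subsets n)

-- Clique number. The default 0 of max is harmless: the empty set is a clique.
ω : ∀ {n} → Graph (Fin n) → ℕ
ω {n} G = max 0 (map ∣_∣ (filter (isClique? G) (subsets n)))

IsIndependent : ∀ {n} → Graph (Fin n) → Subset n → Set
IsIndependent G S = ∀ u v → u ∈ S → v ∈ S → ¬ Adj G u v

-- The parts are the fibres of part; empty fibres may simply be discarded.
IsCompleteMultipartite : ∀ {V} → Graph V → Set
IsCompleteMultipartite {V} G =
  ∃[ k ] Σ[ part ∈ (V → Fin k) ] (∀ u v → Adj G u v ⇔ part u ≢ part v)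

-- The partition of the vertex set is V₁, ∁ V₁; either class may be empty.
IsMultisplit : ∀ {n} → Graph (Fin n) → Set
IsMultisplit G =
  ∃[ V₁ ] IsCompleteMultipartite (G [ V₁ ]) × IsIndependent G (∁ V₁)

{-# OPTIONS --safe #-}
-- Fix a maximum clique Q.  Let V₁ be the set of vertices with exactly one
-- non-neighbour in Q (a vertex of Q being its own non-neighbour); maximality
-- leaves at least two non-neighbours in Q to every vertex outside V₁.
--
-- Grouping V₁ by the missed vertex of Q exhibits a complete multipartite graph:
-- adjacent vertices missing the same q could replace q in Q, and non-adjacent
-- x, y missing q ≠ q' would give (K₁ ∪ K₂) + K_p on y, {x, q'} and Q \ {q, q'}.
--
-- Suppose x ~ y with x, y ∉ V₁.  As (K₁ ∪ K₂) + K_p is excluded, each has fewer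
-- than p neighbours in Q, so they have two common non-neighbours a, b ∈ Q.  A
-- neighbour of x in Q would span a butterfly or a hammer with a, b, x, y, so x
-- and y have no neighbours in Q.  Nor can a neighbour of x have exactly one
-- non-neighbour in Q: with two of its neighbours in Q and x, y it would again span
-- a butterfly or a hammer.  Hence having no neighbour in Q spreads along every path
-- from x and, by connectedness, reaches Q itself, which is absurd.
module Submission where

open import Defs
open import Data.Bool using (true)
open import Data.Empty using (⊥; ⊥-elim)
open import Data.Fin using (Fin; zero; suc)
open import Data.Fin.Properties using (_≟_; all?; any?; suc-injective)
open import Data.Fin.Subset using (Subset; inside; outside; _∈_; _∉_; _⊆_; _∪_; _─_; _-_; ⁅_⁆; ∣_∣) renaming (⊥ to ∅)
open import Data.Fin.Subset.Properties using (_∈?_; ∉⊥; ∣⊥∣≡0; x∈⁅x⁆; x∈⁅y⁆⇒x≡y; ∣⁅x⁆∣≡1; p⊆q⇒∣p∣≤∣q∣; p⊂q⇒∣p∣<∣q∣; p⊆p∪q; x∈p∪q⁺; x∈p∪q⁻; p─q⊆p; x∈p∧x≢y⇒x∈p-y; x∈∁p⇒x∉p)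
open import Data.List using ([]; _∷_; map; filter; allFin)
open import Data.List.Extrema.Nat using (argmax-sel; xs≤max)
import Data.List.Membership.Propositional as List
open import Data.List.Membership.Propositional.Properties using (∈-map⁺; ∈-map⁻; ∈-++⁺ˡ; ∈-++⁺ʳ; ∈-filter⁺; ∈-filter⁻; ∈-allFin)
import Data.List.Relation.Unary.All as All
open import Data.List.Relation.Unary.All using (All; []; _∷_)
open import Data.List.Relation.Unary.AllPairs as AllPairs using (AllPairs; []; _∷_)
open import Data.List.Relation.Unary.Any using (here; there)
open import Data.Nat using (ℕ; zero; suc; _+_; _*_; _≤_; _<_; _≥_; z≤n; s≤s)
open import Data.Nat.Properties using (≤-refl; ≤-trans; ≤-reflexive; +-mono-≤; +-monoˡ-≤; +-monoʳ-≤; +-cancelˡ-≤; +-suc; +-comm; +-identityʳ; m≤n⇒m≤1+n; ≰⇒>; <⇒≱; module ≤-Reasoning)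
open import Data.Product using (-,_; _×_; _,_; ∃; ∃-syntax; proj₁; proj₂)
open import Data.Sum using (_⊎_; inj₁; inj₂)
open import Data.Vec using ([]; _∷_; here; there; lookup; tabulate)
open import Data.Vec.Properties using (lookup⇒[]=; []=⇒lookup; lookup∘tabulate)
open import Data.Vec.Properties.WithK using ([]=-irrelevant)
open import Function using (_∘_; _⇔_; mk⇔; Equivalence; mk↔ₛ′)
open import Function.Definitions using (Injective)
open import Level using (0ℓ)
open import Relation.Binary using (Rel; Symmetric; Reflexive)
open import Relation.Binary.Construct.Closure.ReflexiveTransitive using (Star; ε; _◅_)
open import Relation.Binary.PropositionalEquality using (_≡_; _≢_; refl; sym; trans; cong; subst)
open import Relation.Nullary using (Dec; yes; no; does; ¬_; ¬?; _×-dec_; _⊎-dec_; _→-dec_; contradiction)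
open import Relation.Nullary.Decidable using (True; False; toWitness; toWitnessFalse; dec-true; decidable-stable; map′)
open import Relation.Unary using (Pred; Decidable)

open Equivalence using (to; from)

-- Finite sets

∣p∪q∣≤∣p∣+∣q∣ : ∀ {n} (p q : Subset n) → ∣ p ∪ q ∣ ≤ ∣ p ∣ + ∣ q ∣
∣p∪q∣≤∣p∣+∣q∣ []            []            = z≤n
∣p∪q∣≤∣p∣+∣q∣ (outside ∷ p) (outside ∷ q) = ∣p∪q∣≤∣p∣+∣q∣ p q
∣p∪q∣≤∣p∣+∣q∣ (outside ∷ p) (inside  ∷ q) =
  ≤-trans (s≤s (∣p∪q∣≤∣p∣+∣q∣ p q)) (≤-reflexive (sym (+-suc ∣ p ∣ ∣ q ∣)))
∣p∪q∣≤∣p∣+∣q∣ (inside  ∷ p) (outside ∷ q) = s≤s (∣p∪q∣≤∣p∣+∣q∣ p q)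
∣p∪q∣≤∣p∣+∣q∣ (inside  ∷ p) (inside  ∷ q) =
  s≤s (≤-trans (∣p∪q∣≤∣p∣+∣q∣ p q) (+-monoʳ-≤ ∣ p ∣ (m≤n⇒m≤1+n ≤-refl)))

p⊆q∪r⇒∣p∣≤∣q∣+∣r∣ : ∀ {n} {p : Subset n} q r → p ⊆ q ∪ r → ∣ p ∣ ≤ ∣ q ∣ + ∣ r ∣
p⊆q∪r⇒∣p∣≤∣q∣+∣r∣ q r p⊆q∪r = ≤-trans (p⊆q⇒∣p∣≤∣q∣ p⊆q∪r) (∣p∪q∣≤∣p∣+∣q∣ q r)

x∈p─q⇒x∉q : ∀ {n} {x : Fin n} (p q : Subset n) → x ∈ p ─ q → x ∉ q
x∈p─q⇒x∉q (_ ∷ p) (outside ∷ q) (there x∈p─q) (there x∈q) = x∈p─q⇒x∉q p q x∈p─q x∈q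
x∈p─q⇒x∉q (_ ∷ p) (inside  ∷ q) (there x∈p─q) (there x∈q) = x∈p─q⇒x∉q p q x∈p─q x∈q

x∈p-y⇒x≢y : ∀ {n} {x y : Fin n} p → x ∈ p - y → x ≢ y
x∈p-y⇒x≢y p x∈p-x refl = x∈p─q⇒x∉q p _ x∈p-x (x∈⁅x⁆ _)

∣p∣≤1+∣p-x∣ : ∀ {n} (p : Subset n) x → ∣ p ∣ ≤ suc ∣ p - x ∣
∣p∣≤1+∣p-x∣ p x = begin
  ∣ p ∣                   ≤⟨ p⊆q∪r⇒∣p∣≤∣q∣+∣r∣ ⁅ x ⁆ (p - x) split ⟩
  ∣ ⁅ x ⁆ ∣ + ∣ p - x ∣   ≡⟨ cong (_+ ∣ p - x ∣) (∣⁅x⁆∣≡1 x) ⟩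
  suc ∣ p - x ∣           ∎
  where
  open ≤-Reasoning
  split : p ⊆ ⁅ x ⁆ ∪ (p - x)
  split {y} y∈p with y ≟ x
  ... | yes refl = x∈p∪q⁺ (inj₁ (x∈⁅x⁆ x))
  ... | no  y≢x  = x∈p∪q⁺ (inj₂ (x∈p∧x≢y⇒x∈p-y y∈p y≢x))

-- Provides the copy of `K p` inside a large clique, and pairs of distinct vertices.
enumerate : ∀ {n k} (p : Subset n) → k ≤ ∣ p ∣ →
  ∃[ e ] (∀ (i : Fin k) → e i ∈ p) × Injective _≡_ _≡_ e
enumerate {k = zero} p _ = (λ ()) , (λ ()) , λ { {()} }
enumerate {k = suc k} (outside ∷ p) k<∣p∣ with enumerate p k<∣p∣
... | e , e∈ , e-inj = suc ∘ e , there ∘ e∈ , e-inj ∘ suc-injective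
enumerate {k = suc k} (inside ∷ p) (s≤s k≤∣p∣) with enumerate p k≤∣p∣
... | e , e∈ , e-inj =
  (λ { zero → zero ; (suc i) → suc (e i) }) ,
  (λ { zero → here ; (suc i) → there (e∈ i) }) ,
  λ { {zero}  {zero}  _  → refl
    ; {suc i} {suc j} eq → cong suc (e-inj (suc-injective eq)) }

twoElements : ∀ {n} (p : Subset n) → 2 ≤ ∣ p ∣ → ∃[ a ] ∃[ b ] a ∈ p × b ∈ p × a ≢ b
twoElements p 2≤∣p∣ with enumerate p 2≤∣p∣
... | e , e∈ , e-inj = e zero , e (suc zero) , e∈ _ , e∈ _ , (λ ()) ∘ e-inj

module _ {n} {P : Pred (Fin n) 0ℓ} (P? : Decidable P) where

  select : Subset n
  select = tabulate (does ∘ P?)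

  ∈-select⁺ : ∀ {x} → P x → x ∈ select
  ∈-select⁺ {x} Px =
    lookup⇒[]= x _ (trans (lookup∘tabulate (does ∘ P?) x) (dec-true (P? x) Px))

  ∈-select⁻ : ∀ {x} → x ∈ select → P x
  ∈-select⁻ {x} x∈ = holds (P? x)
    (trans (sym (lookup∘tabulate (does ∘ P?) x)) ([]=⇒lookup x∈))
    where
    holds : ∀ {A : Set} (A? : Dec A) → does A? ≡ true → A
    holds (yes a) _ = a

∈-subsets : ∀ {n} (p : Subset n) → p List.∈ subsets n
∈-subsets []            = here refl
∈-subsets (outside ∷ p) = ∈-++⁺ˡ (∈-map⁺ (outside ∷_) (∈-subsets p))
∈-subsets (inside  ∷ p) = ∈-++⁺ʳ _ (∈-map⁺ (inside ∷_) (∈-subsets p))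

-- Symmetry and reflexivity supply the rest, so an adjacency table need only list its upper
-- triangle.
allPairs-lookup : ∀ {A : Set} {R : Rel A 0ℓ} → Reflexive R → Symmetric R →
  ∀ {xs} → AllPairs R xs → ∀ {x y} → x List.∈ xs → y List.∈ xs → R x y
allPairs-lookup rfl sm (rs ∷ _)  (here refl) (here refl) = rfl
allPairs-lookup rfl sm (rs ∷ _)  (here refl) (there y∈)  = All.lookup rs y∈
allPairs-lookup rfl sm (rs ∷ _)  (there x∈)  (here refl) = sm (All.lookup rs x∈)
allPairs-lookup rfl sm (_ ∷ rss) (there x∈)  (there y∈)  = allPairs-lookup rfl sm rss x∈ y∈

-- Stands in for finiteness: it makes the image of a map decidable and passes to the sum types on
-- which joins live.
Searchable : Set → Set₁
Searchable V = ∀ {P : Pred V 0ℓ} → Decidable P → Dec (∃ P)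

⊎-searchable : ∀ {V W} → Searchable V → Searchable W → Searchable (V ⊎ W)
⊎-searchable anyV anyW P? = map′
  (λ { (inj₁ (v , Pv)) → inj₁ v , Pv ; (inj₂ (w , Pw)) → inj₂ w , Pw })
  (λ { (inj₁ v , Pv) → inj₁ (v , Pv) ; (inj₂ w , Pw) → inj₂ (w , Pw) })
  (anyV (P? ∘ inj₁) ⊎-dec anyW (P? ∘ inj₂))

-- Recognising induced subgraphs

-- A map out of a point-determining graph that preserves and reflects adjacency is
-- automatically injective.
PointDetermining : ∀ {V} → Graph V → Set
PointDetermining H =
  ∀ u v → (∀ w → (Adj H u w → Adj H v w) × (Adj H v w → Adj H u w)) → u ≡ v

pointDetermining? : ∀ {m} (H : Graph (Fin m)) → Dec (PointDetermining H)
pointDetermining? H = all? λ u → all? λ v →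
  (all? λ w → (adj? H u w →-dec adj? H v w) ×-dec (adj? H v w →-dec adj? H u w))
    →-dec (u ≟ v)

module _ {n} (G : Graph (Fin n)) where

  infix 4 _~_
  _~_ : Rel (Fin n) 0ℓ
  _~_ = Adj G

  -- The image of `f` serves as `S`; searching `V` recovers preimages, and they are unique because
  -- `H` is point-determining.
  induced : ∀ {V} {H : Graph V} → Searchable V → PointDetermining H →
    (f : V → Fin n) → (∀ u v → Adj H u v ⇔ f u ~ f v) → ∃[ S ] H ≅ G [ S ]
  induced {V} {H} search det f f-adj =
    S , mk↔ₛ′ (λ v → f v , ∈-select⁺ image? (v , refl)) preimage
          (λ (x , x∈) → S-≡ (proj₂ (∈-select⁻ image? x∈)))
          (λ v → f-inj (proj₂ (∈-select⁻ image? (∈-select⁺ image? (v , refl)))))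
      , f-adj
    where
    image? : Decidable (λ x → ∃[ v ] f v ≡ x)
    image? x = search (λ v → f v ≟ x)

    S : Subset n
    S = select image?

    preimage : ∃ (_∈ S) → V
    preimage (x , x∈) = proj₁ (∈-select⁻ image? x∈)

    S-≡ : ∀ {x y} {x∈ : x ∈ S} {y∈ : y ∈ S} → x ≡ y → _≡_ {A = ∃ (_∈ S)} (x , x∈) (y , y∈)
    S-≡ {x} refl = cong (x ,_) ([]=-irrelevant _ _)

    f-inj : ∀ {u v} → f u ≡ f v → u ≡ v
    f-inj {u} {v} eq = det u v λ w →
      (λ uw → from (f-adj v w) (subst (_~ f w) eq (to (f-adj u w) uw))) ,
      (λ vw → from (f-adj u w) (subst (_~ f w) (sym eq) (to (f-adj v w) vw)))

  -- The side of `H` is settled by evaluation, so a table entry only carries the fact about `G`.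
  data Agree {m} (H : Graph (Fin m)) (f : Fin m → Fin n) (i j : Fin m) : Set where
    edge    : {True  (adj? H i j)} →   f i ~ f j → Agree H f i j
    nonEdge : {False (adj? H i j)} → ¬ f i ~ f j → Agree H f i j

  fromTable : ∀ {m} (H : Graph (Fin m)) {_ : True (pointDetermining? H)} (f : Fin m → Fin n) →
    AllPairs (Agree H f) (allFin m) → ∃[ S ] H ≅ G [ S ]
  fromTable {m} H {det} f table = induced {H = H} any? (toWitness det) f λ i j →
    allPairs-lookup {R = λ i j → Adj H i j ⇔ f i ~ f j}
      (mk⇔ (λ ii → ⊥-elim (irrefl H refl ii)) (λ ii → ⊥-elim (irrefl G refl ii)))
      (λ ij → mk⇔ (symm G ∘ to ij ∘ symm H) (symm H ∘ from ij ∘ symm G))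
      (AllPairs.map agree⇒⇔ table) (∈-allFin i) (∈-allFin j)
    where
    agree⇒⇔ : ∀ {i j} → Agree H f i j → Adj H i j ⇔ f i ~ f j
    agree⇒⇔ (edge {ij} fij)     = mk⇔ (λ _ → fij) (λ _ → toWitness ij)
    agree⇒⇔ (nonEdge {¬ij} ¬fij) =
      mk⇔ (λ ij → ⊥-elim (toWitnessFalse ¬ij ij)) (λ fij → ⊥-elim (¬fij fij))

  -- Only the pair `c`, `y` is left open: an edge there gives two triangles meeting in `c`, a
  -- non-edge gives a hammer.
  triangleWithPath : ¬ (∃[ S ] butterfly ≅ G [ S ]) → ¬ (∃[ S ] hammer ≅ G [ S ]) →
    ∀ {a b c x y} → a ~ b → a ~ c → b ~ c → c ~ x → x ~ y →
    ¬ a ~ x → ¬ a ~ y → ¬ b ~ x → ¬ b ~ y → ⊥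
  triangleWithPath ¬butterfly ¬hammer {a} {b} {c} {x} {y} ab ac bc cx xy ¬ax ¬ay ¬bx ¬by
    with adj? G c y
  -- `c` is listed first because vertex 0 of `butterfly` is the one shared by both triangles.
  ... | yes cy = ¬butterfly (fromTable butterfly (lookup (c ∷ a ∷ b ∷ x ∷ y ∷ []))
    ( (edge (symm G ac) ∷ edge (symm G bc) ∷ edge cx ∷ edge cy ∷ [])
    ∷ (edge ab ∷ nonEdge ¬ax ∷ nonEdge ¬ay ∷ [])
    ∷ (nonEdge ¬bx ∷ nonEdge ¬by ∷ [])
    ∷ (edge xy ∷ [])
    ∷ [] ∷ []))
  ... | no ¬cy = ¬hammer (fromTable hammer (lookup (a ∷ b ∷ c ∷ x ∷ y ∷ []))
    ( (edge ab ∷ edge ac ∷ nonEdge ¬ax ∷ nonEdge ¬ay ∷ [])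
    ∷ (edge bc ∷ nonEdge ¬bx ∷ nonEdge ¬by ∷ [])
    ∷ (edge cx ∷ nonEdge ¬cy ∷ [])
    ∷ (edge xy ∷ [])
    ∷ [] ∷ []))

  -- `x` plays `K 1`, the edge `a`, `b` plays `K 2`, and some `p` vertices of `S` play `K p`.
  cliqueWithFan : ∀ {p} → ¬ (∃[ S ] ((K 1 ⊍ K 2) ⋈ K p) ≅ G [ S ]) →
    ∀ {x a b} S → IsClique G S → p ≤ ∣ S ∣ → a ~ b → ¬ x ~ a → ¬ x ~ b →
    (∀ s → s ∈ S → x ~ s × a ~ s × b ~ s) → ⊥
  cliqueWithFan {p} ¬fan {x} {a} {b} S clique p≤∣S∣ ab ¬xa ¬xb joined =
    ¬fan (induced {H = (K 1 ⊍ K 2) ⋈ K p} (⊎-searchable (⊎-searchable any? any?) any?) det f f-adj)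
    where
    e : Fin p → Fin n
    e = proj₁ (enumerate S p≤∣S∣)

    e∈S : ∀ i → e i ∈ S
    e∈S = proj₁ (proj₂ (enumerate S p≤∣S∣))

    e-inj : Injective _≡_ _≡_ e
    e-inj = proj₂ (proj₂ (enumerate S p≤∣S∣))

    f : (Fin 1 ⊎ Fin 2) ⊎ Fin p → Fin n
    f (inj₁ (inj₁ _))          = x
    f (inj₁ (inj₂ zero))       = a
    f (inj₁ (inj₂ (suc zero))) = b
    f (inj₂ i)                 = e i

    -- The vertex of `K 1` and an end of `K 2` are separated by the other end; two adjacent vertices
    -- are separated by either of them, which is not its own neighbour.
    det : PointDetermining ((K 1 ⊍ K 2) ⋈ K p)
    det (inj₁ (inj₁ zero)) (inj₁ (inj₁ zero)) _ = refl
    det (inj₁ (inj₁ zero)) (inj₁ (inj₂ zero)) same =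
      ⊥-elim (proj₂ (same (inj₁ (inj₂ (suc zero)))) λ ())
    det (inj₁ (inj₁ zero)) (inj₁ (inj₂ (suc zero))) same =
      ⊥-elim (proj₂ (same (inj₁ (inj₂ zero))) λ ())
    det (inj₁ (inj₂ zero)) (inj₁ (inj₁ zero)) same =
      ⊥-elim (proj₁ (same (inj₁ (inj₂ (suc zero)))) λ ())
    det (inj₁ (inj₂ (suc zero))) (inj₁ (inj₁ zero)) same =
      ⊥-elim (proj₁ (same (inj₁ (inj₂ zero))) λ ())
    det (inj₁ (inj₂ i)) (inj₁ (inj₂ j)) same with i ≟ j
    ... | yes refl = refl
    ... | no  i≢j  = ⊥-elim (proj₁ (same (inj₁ (inj₂ j))) i≢j refl)
    det (inj₁ u) (inj₂ j) same = ⊥-elim (proj₁ (same (inj₂ j)) _ refl)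
    det (inj₂ i) (inj₁ v) same = ⊥-elim (proj₂ (same (inj₂ i)) _ refl)
    det (inj₂ i) (inj₂ j) same with i ≟ j
    ... | yes refl = refl
    ... | no  i≢j  = ⊥-elim (proj₁ (same (inj₂ j)) i≢j refl)

    joined′ : ∀ u i → f (inj₁ u) ~ e i
    joined′ (inj₁ _)          i = proj₁ (joined (e i) (e∈S i))
    joined′ (inj₂ zero)       i = proj₁ (proj₂ (joined (e i) (e∈S i)))
    joined′ (inj₂ (suc zero)) i = proj₂ (proj₂ (joined (e i) (e∈S i)))

    f-adj : ∀ u v → Adj ((K 1 ⊍ K 2) ⋈ K p) u v ⇔ f u ~ f v
    f-adj (inj₁ (inj₁ zero)) (inj₁ (inj₁ zero)) =
      mk⇔ (λ z → ⊥-elim (z refl)) (λ xx → ⊥-elim (irrefl G refl xx))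
    f-adj (inj₁ (inj₁ zero)) (inj₁ (inj₂ zero)) = mk⇔ ⊥-elim ¬xa
    f-adj (inj₁ (inj₁ zero)) (inj₁ (inj₂ (suc zero))) = mk⇔ ⊥-elim ¬xb
    f-adj (inj₁ (inj₂ zero)) (inj₁ (inj₁ zero)) = mk⇔ ⊥-elim (¬xa ∘ symm G)
    f-adj (inj₁ (inj₂ (suc zero))) (inj₁ (inj₁ zero)) = mk⇔ ⊥-elim (¬xb ∘ symm G)
    f-adj (inj₁ (inj₂ zero)) (inj₁ (inj₂ zero)) =
      mk⇔ (λ z → ⊥-elim (z refl)) (λ aa → ⊥-elim (irrefl G refl aa))
    f-adj (inj₁ (inj₂ zero)) (inj₁ (inj₂ (suc zero))) = mk⇔ (λ _ → ab) (λ _ ())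
    f-adj (inj₁ (inj₂ (suc zero))) (inj₁ (inj₂ zero)) = mk⇔ (λ _ → symm G ab) (λ _ ())
    f-adj (inj₁ (inj₂ (suc zero))) (inj₁ (inj₂ (suc zero))) =
      mk⇔ (λ z → ⊥-elim (z refl)) (λ bb → ⊥-elim (irrefl G refl bb))
    f-adj (inj₁ u) (inj₂ i) = mk⇔ (λ _ → joined′ u i) _
    f-adj (inj₂ i) (inj₁ u) = mk⇔ (λ _ → symm G (joined′ u i)) _
    f-adj (inj₂ i) (inj₂ j) = mk⇔
      (λ i≢j → clique _ _ (e∈S i) (e∈S j) (i≢j ∘ e-inj))
      (λ eiej i≡j → irrefl G (cong e i≡j) eiej)

  -- Maximum cliques

  clique-⊆ : ∀ {S T} → S ⊆ T → IsClique G T → IsClique G S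
  clique-⊆ S⊆T clique u v u∈S v∈S = clique u v (S⊆T u∈S) (S⊆T v∈S)

  module _ {S : Subset n} {v : Fin n} (v~S : ∀ s → s ∈ S → v ~ s) where

    clique-∪⁅⁆ : IsClique G S → IsClique G (S ∪ ⁅ v ⁆)
    clique-∪⁅⁆ clique x y x∈ y∈ x≢y with x∈p∪q⁻ S ⁅ v ⁆ x∈ | x∈p∪q⁻ S ⁅ v ⁆ y∈
    ... | inj₁ x∈S | inj₁ y∈S = clique x y x∈S y∈S x≢y
    ... | inj₁ x∈S | inj₂ y∈v rewrite x∈⁅y⁆⇒x≡y v y∈v = symm G (v~S x x∈S)
    ... | inj₂ x∈v | inj₁ y∈S rewrite x∈⁅y⁆⇒x≡y v x∈v = v~S y y∈S
    ... | inj₂ x∈v | inj₂ y∈v =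
      contradiction (trans (x∈⁅y⁆⇒x≡y v x∈v) (sym (x∈⁅y⁆⇒x≡y v y∈v))) x≢y

    -- No vertex is its own neighbour, so `v` lies outside `S`.
    ∣S∣<∣S∪⁅v⁆∣ : ∣ S ∣ < ∣ S ∪ ⁅ v ⁆ ∣
    ∣S∣<∣S∪⁅v⁆∣ = p⊂q⇒∣p∣<∣q∣
      ( p⊆p∪q ⁅ v ⁆ , v , x∈p∪q⁺ {p = S} (inj₂ (x∈⁅x⁆ v))
      , λ v∈S → irrefl G refl (v~S v v∈S))

  IsMaximumClique : Subset n → Set
  IsMaximumClique Q = IsClique G Q × (∀ S → IsClique G S → ∣ S ∣ ≤ ∣ Q ∣)

  maximumClique : ∃[ Q ] IsMaximumClique Q × ω G ≤ ∣ Q ∣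
  maximumClique with attained
    where
    attained : ∃[ Q ] IsClique G Q × ω G ≡ ∣ Q ∣
    attained with argmax-sel (λ k → k) 0 (map ∣_∣ (filter (isClique? G) (subsets n)))
    -- The default value 0 of `max` is attained by the empty clique.
    ... | inj₁ ω≡0 = ∅ , (λ _ _ u∈∅ → contradiction u∈∅ ∉⊥) , trans ω≡0 (sym (∣⊥∣≡0 n))
    ... | inj₂ ω∈ with ∈-map⁻ ∣_∣ ω∈
    ... | Q , Q∈ , ω≡∣Q∣ = Q , proj₂ (∈-filter⁻ (isClique? G) {xs = subsets n} Q∈) , ω≡∣Q∣
  ... | Q , clique , ω≡∣Q∣ = Q , (clique , λ S S-clique → ≤-trans
    (All.lookup (xs≤max 0 _)
      (∈-map⁺ ∣_∣ (∈-filter⁺ (isClique? G) (∈-subsets S) S-clique)))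
    (≤-reflexive ω≡∣Q∣)) , ≤-reflexive ω≡∣Q∣

  -- The multisplit partition

  module _ {p : ℕ} (1<p : 1 < p) (connected : Connected G)
    (¬butterfly : ¬ (∃[ S ] butterfly ≅ G [ S ]))
    (¬hammer    : ¬ (∃[ S ] hammer ≅ G [ S ]))
    (¬fan       : ¬ (∃[ S ] ((K 1 ⊍ K 2) ⋈ K p) ≅ G [ S ]))
    {Q : Subset n} (Q-clique : IsClique G Q) (Q-maximum : ∀ S → IsClique G S → ∣ S ∣ ≤ ∣ Q ∣)
    (2p≤∣Q∣ : p + p ≤ ∣ Q ∣)
    where

    MissesOnly : Fin n → Fin n → Set
    MissesOnly v q = q ∈ Q × ¬ v ~ q × (∀ r → r ∈ Q → r ≢ q → v ~ r)

    MissesOne : Fin n → Set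
    MissesOne v = ∃[ q ] MissesOnly v q

    missesOne? : Decidable MissesOne
    missesOne? v = any? λ q → (q ∈? Q) ×-dec ¬? (adj? G v q) ×-dec
      all? λ r → (r ∈? Q) →-dec ¬? (r ≟ q) →-dec adj? G v r

    -- As `p` is at least 2, `Q` has at least `2 + p` vertices, and each deletion costs at most one.
    p≤∣Q-q-r∣ : ∀ q r → p ≤ ∣ Q - q - r ∣
    p≤∣Q-q-r∣ q r = +-cancelˡ-≤ 2 p _ (begin
      2 + p                 ≤⟨ +-monoˡ-≤ p 1<p ⟩
      p + p                 ≤⟨ 2p≤∣Q∣ ⟩
      ∣ Q ∣                 ≤⟨ ∣p∣≤1+∣p-x∣ Q q ⟩
      1 + ∣ Q - q ∣         ≤⟨ s≤s (∣p∣≤1+∣p-x∣ (Q - q) r) ⟩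
      2 + ∣ Q - q - r ∣     ∎)
      where open ≤-Reasoning

    parts-independent : ∀ {x y q} → MissesOnly x q → MissesOnly y q → ¬ x ~ y
    parts-independent {x} {y} {q} (_ , _ , x~) (_ , _ , y~) xy = <⇒≱ larger
      (Q-maximum _ (clique-∪⁅⁆ y~Q-q∪x (clique-∪⁅⁆ x~Q-q (clique-⊆ (p─q⊆p Q ⁅ q ⁆) Q-clique))))
      where
      open ≤-Reasoning

      x~Q-q : ∀ s → s ∈ Q - q → x ~ s
      x~Q-q s s∈ = x~ s (p─q⊆p Q ⁅ q ⁆ s∈) (x∈p-y⇒x≢y Q s∈)

      y~Q-q∪x : ∀ s → s ∈ (Q - q) ∪ ⁅ x ⁆ → y ~ s
      y~Q-q∪x s s∈ with x∈p∪q⁻ (Q - q) ⁅ x ⁆ s∈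
      ... | inj₁ s∈Q-q = y~ s (p─q⊆p Q ⁅ q ⁆ s∈Q-q) (x∈p-y⇒x≢y Q s∈Q-q)
      ... | inj₂ s∈x rewrite x∈⁅y⁆⇒x≡y x s∈x = symm G xy

      larger : ∣ Q ∣ < ∣ ((Q - q) ∪ ⁅ x ⁆) ∪ ⁅ y ⁆ ∣
      larger = begin
        1 + ∣ Q ∣                          ≤⟨ s≤s (∣p∣≤1+∣p-x∣ Q q) ⟩
        2 + ∣ Q - q ∣                      ≤⟨ s≤s (∣S∣<∣S∪⁅v⁆∣ x~Q-q) ⟩
        1 + ∣ (Q - q) ∪ ⁅ x ⁆ ∣            ≤⟨ ∣S∣<∣S∪⁅v⁆∣ y~Q-q∪x ⟩
        ∣ ((Q - q) ∪ ⁅ x ⁆) ∪ ⁅ y ⁆ ∣      ∎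

    -- Since `x` misses only `q`, it is adjacent to `r`; were `y` not adjacent to `x`, it would miss
    -- both ends of this edge.
    parts-joined : ∀ {x y q r} → MissesOnly x q → MissesOnly y r → q ≢ r → x ~ y
    parts-joined {x} {y} {q} {r} (q∈Q , _ , x~) (r∈Q , ¬y~r , y~) q≢r =
      decidable-stable (adj? G x y) λ ¬xy →
        cliqueWithFan ¬fan (Q - q - r) (clique-⊆ (proj₁ ∘ in-Q) Q-clique)
          (p≤∣Q-q-r∣ q r) (x~ r r∈Q (q≢r ∘ sym)) (¬xy ∘ symm G) ¬y~r λ s s∈ →
          let s∈Q , s≢q , s≢r = in-Q s∈ in
          y~ s s∈Q s≢r , x~ s s∈Q s≢q , Q-clique r s r∈Q s∈Q (s≢r ∘ sym)
      where
      in-Q : ∀ {s} → s ∈ Q - q - r → s ∈ Q × s ≢ q × s ≢ r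
      in-Q s∈ = p─q⊆p Q ⁅ q ⁆ s∈Q-q , x∈p-y⇒x≢y Q s∈Q-q , x∈p-y⇒x≢y (Q - q) s∈
        where s∈Q-q = p─q⊆p (Q - q) ⁅ r ⁆ s∈

    -- If `v` had no non-neighbour in `Q`, adding it would give a larger clique; a single one would
    -- make it satisfy `MissesOne`.
    missesTwo : ∀ {v} → ¬ MissesOne v →
      ∃[ a ] ∃[ b ] a ∈ Q × b ∈ Q × a ≢ b × ¬ v ~ a × ¬ v ~ b
    missesTwo {v} ¬one with any? (λ a → (a ∈? Q) ×-dec ¬? (adj? G v a))
    ... | no none = contradiction (Q-maximum _ (clique-∪⁅⁆ v~Q Q-clique)) (<⇒≱ (∣S∣<∣S∪⁅v⁆∣ v~Q))
      where
      v~Q : ∀ s → s ∈ Q → v ~ s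
      v~Q s s∈Q = decidable-stable (adj? G v s) λ ¬vs → none (s , s∈Q , ¬vs)
    ... | yes (a , a∈Q , ¬va)
      with any? (λ b → (b ∈? Q) ×-dec ¬? (b ≟ a) ×-dec ¬? (adj? G v b))
    ... | yes (b , b∈Q , b≢a , ¬vb) = a , b , a∈Q , b∈Q , b≢a ∘ sym , ¬va , ¬vb
    ... | no none = contradiction (a , a∈Q , ¬va , others) ¬one
      where
      others : ∀ r → r ∈ Q → r ≢ a → v ~ r
      others r r∈Q r≢a = decidable-stable (adj? G v r) λ ¬vr → none (r , r∈Q , r≢a , ¬vr)

    neighbour? : ∀ v → Decidable (λ s → s ∈ Q × v ~ s)
    neighbour? v s = (s ∈? Q) ×-dec adj? G v s

    -- Otherwise `v`, two vertices of `Q` that it misses and `p` of its neighbours in `Q` form the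
    -- excluded join.
    fewNeighbours : ∀ {v} → ¬ MissesOne v → ∣ select (neighbour? v) ∣ < p
    fewNeighbours {v} ¬one with missesTwo ¬one
    ... | a , b , a∈Q , b∈Q , a≢b , ¬va , ¬vb = ≰⇒> λ p≤ →
      cliqueWithFan ¬fan (select (neighbour? v))
        (clique-⊆ (proj₁ ∘ ∈-select⁻ (neighbour? v)) Q-clique) p≤
        (Q-clique a b a∈Q b∈Q a≢b) ¬va ¬vb λ s s∈ →
        let s∈Q , vs = ∈-select⁻ (neighbour? v) s∈ in
        vs , Q-clique a s a∈Q s∈Q (λ { refl → ¬va vs })
           , Q-clique b s b∈Q s∈Q (λ { refl → ¬vb vs })

    commonNonNeighbour? : ∀ x y → Decidable (λ s → s ∈ Q × ¬ x ~ s × ¬ y ~ s)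
    commonNonNeighbour? x y s = (s ∈? Q) ×-dec ¬? (adj? G x s) ×-dec ¬? (adj? G y s)

    -- The two neighbourhoods cover at most 2(p - 1) of the at least 2p vertices of `Q`. Adding
    -- `X + Y` to both sides avoids subtraction.
    commonNonNeighbours : ∀ {x y} → ¬ MissesOne x → ¬ MissesOne y →
      2 ≤ ∣ select (commonNonNeighbour? x y) ∣
    commonNonNeighbours {x} {y} ¬one-x ¬one-y = +-cancelˡ-≤ (X + Y) 2 Z (begin
      X + Y + 2        ≡⟨ +-comm (X + Y) 2 ⟩
      2 + (X + Y)      ≡⟨ cong suc (+-suc X Y) ⟨
      suc X + suc Y    ≤⟨ +-mono-≤ (fewNeighbours ¬one-x) (fewNeighbours ¬one-y) ⟩
      p + p            ≤⟨ 2p≤∣Q∣ ⟩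
      ∣ Q ∣            ≤⟨ p⊆q∪r⇒∣p∣≤∣q∣+∣r∣ (Nx ∪ Ny) _ cover ⟩
      ∣ Nx ∪ Ny ∣ + Z  ≤⟨ +-monoˡ-≤ Z (∣p∪q∣≤∣p∣+∣q∣ Nx Ny) ⟩
      X + Y + Z        ∎)
      where
      open ≤-Reasoning
      Nx Ny : Subset n
      Nx = select (neighbour? x)
      Ny = select (neighbour? y)

      X Y Z : ℕ
      X = ∣ Nx ∣
      Y = ∣ Ny ∣
      Z = ∣ select (commonNonNeighbour? x y) ∣

      cover : Q ⊆ (Nx ∪ Ny) ∪ select (commonNonNeighbour? x y)
      cover {s} s∈Q with adj? G x s | adj? G y s
      ... | yes xs | _      = x∈p∪q⁺ (inj₁ (x∈p∪q⁺ (inj₁ (∈-select⁺ (neighbour? x) (s∈Q , xs)))))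
      ... | no _   | yes ys = x∈p∪q⁺ (inj₁ (x∈p∪q⁺ (inj₂ (∈-select⁺ (neighbour? y) (s∈Q , ys)))))
      ... | no ¬xs | no ¬ys =
        x∈p∪q⁺ (inj₂ (∈-select⁺ (commonNonNeighbour? x y) (s∈Q , ¬xs , ¬ys)))

    -- Spreading isolation from `Q` along paths

    Isolated : Fin n → Set
    Isolated v = ∀ s → s ∈ Q → ¬ v ~ s

    edge⇒isolated : ∀ {x y} → ¬ MissesOne x → ¬ MissesOne y → x ~ y → Isolated x
    edge⇒isolated {x} {y} ¬one-x ¬one-y xy c c∈Q xc
      with twoElements _ (commonNonNeighbours ¬one-x ¬one-y)
    ... | a , b , a∈ , b∈ , a≢b
      with ∈-select⁻ (commonNonNeighbour? x y) a∈ | ∈-select⁻ (commonNonNeighbour? x y) b∈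
    ... | a∈Q , ¬xa , ¬ya | b∈Q , ¬xb , ¬yb =
      triangleWithPath ¬butterfly ¬hammer (Q-clique a b a∈Q b∈Q a≢b)
        (Q-clique a c a∈Q c∈Q (λ { refl → ¬xa xc })) (Q-clique b c b∈Q c∈Q (λ { refl → ¬xb xc }))
        (symm G xc) xy (¬xa ∘ symm G) (¬ya ∘ symm G) (¬xb ∘ symm G) (¬yb ∘ symm G)

    missesOne⇒twoNeighbours : ∀ {v} → MissesOne v →
      ∃[ a ] ∃[ b ] a ∈ Q × b ∈ Q × a ≢ b × v ~ a × v ~ b
    missesOne⇒twoNeighbours {v} (q , _ , _ , v~)
      -- Deleting `q` a second time changes nothing and lets the bound for two deletions apply.
      with twoElements (Q - q - q) (≤-trans 1<p (p≤∣Q-q-r∣ q q))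
    ... | a , b , a∈ , b∈ , a≢b = a , b , in-Q a∈ , in-Q b∈ , a≢b ,
        v~ a (in-Q a∈) (x∈p-y⇒x≢y (Q - q) a∈) , v~ b (in-Q b∈) (x∈p-y⇒x≢y (Q - q) b∈)
      where
      in-Q : Q - q - q ⊆ Q
      in-Q = p─q⊆p Q ⁅ q ⁆ ∘ p─q⊆p (Q - q) ⁅ q ⁆

    isolated⇒¬missesOne : ∀ {v} → Isolated v → ¬ MissesOne v
    isolated⇒¬missesOne iso one with missesOne⇒twoNeighbours one
    ... | a , _ , a∈Q , _ , _ , va , _ = iso a a∈Q va

    -- If `w` fails `MissesOne`, then so do both ends of the edge `w`, `u`, and `edge⇒isolated`
    -- applies. Otherwise `w` forms a triangle with two vertices of `Q`, and the path `w`, `u`, `v`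
    -- leaves it: this is what the isolated neighbour `v` is for.
    isolated-step : ∀ {u v w} → Isolated u → Isolated v → u ~ v → u ~ w → Isolated w
    isolated-step {u} {v} {w} iso-u iso-v uv uw with missesOne? w
    ... | no ¬one = edge⇒isolated ¬one (isolated⇒¬missesOne iso-u) (symm G uw)
    ... | yes one with missesOne⇒twoNeighbours one
    ... | a , b , a∈Q , b∈Q , a≢b , wa , wb = ⊥-elim
      (triangleWithPath ¬butterfly ¬hammer (Q-clique a b a∈Q b∈Q a≢b) (symm G wa) (symm G wb)
        (symm G uw) uv (iso-u a a∈Q ∘ symm G) (iso-v a a∈Q ∘ symm G)
        (iso-u b b∈Q ∘ symm G) (iso-v b b∈Q ∘ symm G))

    -- The invariant is an edge with both ends isolated; after each step the vertex just left
    -- becomes the isolated neighbour.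
    isolated-path : ∀ {u v w} → Isolated u → Isolated v → u ~ v → Star _~_ u w → Isolated w
    isolated-path iso-u iso-v uv ε             = iso-u
    isolated-path iso-u iso-v uv (uu′ ◅ path) =
      isolated-path (isolated-step iso-u iso-v uv uu′) iso-u (symm G uu′) path

    outside-independent : ∀ {x y} → ¬ MissesOne x → ¬ MissesOne y → ¬ x ~ y
    -- Supplies distinct `a` and `b` in `Q`: isolation would reach `a`, which is adjacent to `b`.
    outside-independent {x} {y} ¬one-x ¬one-y xy with missesTwo ¬one-x
    ... | a , b , a∈Q , b∈Q , a≢b , _ =
      isolated-path (edge⇒isolated ¬one-x ¬one-y xy) (edge⇒isolated ¬one-y ¬one-x (symm G xy)) xy
        (connected x a) b b∈Q (Q-clique a b a∈Q b∈Q a≢b)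

    multisplit : IsMultisplit G
    multisplit = V₁ , (n , part , λ u v → mk⇔
        (λ uv same → parts-independent (misses u)
          (subst (MissesOnly (proj₁ v)) (sym same) (misses v)) uv)
        (parts-joined (misses u) (misses v)))
      , λ u v u∈ v∈ → outside-independent
          (x∈∁p⇒x∉p u∈ ∘ ∈-select⁺ missesOne?) (x∈∁p⇒x∉p v∈ ∘ ∈-select⁺ missesOne?)
      where
      V₁ : Subset n
      V₁ = select missesOne?

      part : ∃ (_∈ V₁) → Fin n
      part (v , v∈) = proj₁ (∈-select⁻ missesOne? v∈)

      misses : ∀ v → MissesOnly (proj₁ v) (part v)
      misses (v , v∈) = proj₂ (∈-select⁻ missesOne? v∈)

theorem3p15 : (p : ℕ) → 1 < p →
    (n : ℕ) (G : Graph (Fin n)) → Connected G →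
    ((-, butterfly) ∷ (-, hammer) ∷ (-, ((K 1 ⊍ K 2) ⋈ K p)) ∷ []) -free G →
    ω G ≥ 2 * p →
    IsMultisplit G
theorem3p15 p 1<p n G connected (¬butterfly ∷ ¬hammer ∷ ¬fan ∷ []) ω≥2p
  with maximumClique G
... | Q , (Q-clique , Q-maximum) , ω≤∣Q∣ =
  multisplit G 1<p connected ¬butterfly ¬hammer ¬fan Q-clique Q-maximum
    -- `2 * p` unfolds to `p + (p + 0)`.
    (≤-trans (≤-reflexive (cong (p +_) (sym (+-identityʳ p)))) (≤-trans ω≥2p ω≤∣Q∣))
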